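{- For any integers $n\ge 1$, $k\geq 1$ and $d \ge 1$, the majority function $\mathrm{Maj}_n:\{0,1\}^n\to\{0,1\}$ satisfies $$\gamma_{d,k}(\mathrm{Maj}_n) \leq \frac{1}{2} + \frac{10d}{\sqrt{n}}.$$
   Context: $\mathrm{Maj}_n(x)=1$ iff the Hamming weight $|x|$ of $x$ satisfies $|x|>n/2$. For a Boolean function $F:\{0,1\}^n\to\{0,1\}$ and $k\ge 1$, the $k$-lift of $F$ is $F_k:\{0,1\}^n\to \mathbb{Z}/2^k\mathbb{Z}$ with $F_k(x)=0$ if $F(x)=0$ and $F_k(x)=2^{k-1}$ if $F(x)=1$. $\mathcal{P}_{d,k}$ denotes the set of multilinear polynomials in $x_1,\dots,x_n$ of degree at most $d$ with coefficients in $\mathbb{Z}/2^k\mathbb{Z}$, evaluated on $\{0,1\}^n$. $\mathrm{agr}(F,G)=\Pr_{x}[F(x)=G(x)]$ for $x$ uniform in $\{0,1\}^n$, and $\gamma_{d,k}(F)=\max_{Q\in\mathcal{P}_{d,k}}\mathrm{agr}(F_k,Q)$. -}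

module Defs where

open import Data.Bool using (Bool; true; false; if_then_else_; _∧_)
open import Data.Nat using (ℕ; zero; suc; _+_; _*_; _∸_; _^_; _<_; _<ᵇ_; _≡ᵇ_)
open import Data.Nat.DivMod using (_%_)
open import Data.List using (List; []; _∷_; [_]; map; _++_)
open import Data.Nat.ListAction using (sum)
open import Data.Nat.Properties using (m^n≢0)
open import Data.Vec using (Vec; []; _∷_)
open import Relation.Binary.PropositionalEquality using (_≡_)

mod2^ : ℕ → ℕ → ℕ
mod2^ k m = _%_ m (2 ^ k) {{m^n≢0 2 k}}

cube : (n : ℕ) → List (Vec Bool n)
cube zero    = [ [] ]
cube (suc n) = map (false ∷_) (cube n) ++ map (true ∷_) (cube n)

weight : {n : ℕ} → Vec Bool n → ℕ
weight []            = 0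
weight (false ∷ xs)  = weight xs
weight (true ∷ xs)   = suc (weight xs)

Maj : (n : ℕ) → Vec Bool n → Bool
Maj n x = n <ᵇ 2 * weight x

-- k-lift of a Boolean value: 0 ↦ 0, 1 ↦ 2^(k-1)  (as a natural number, read mod 2^k).
lift : ℕ → Bool → ℕ
lift k false = 0
lift k true  = 2 ^ (k ∸ 1)

-- Monomial x^S = ∏_{i ∈ S} x_i, where S ⊆ [n] is given by its indicator vector.
monomial : {n : ℕ} → Vec Bool n → Vec Bool n → ℕ
monomial []            []            = 1
monomial (false ∷ S)   (_ ∷ x)       = monomial S x
monomial (true ∷ S)    (false ∷ x)   = 0
monomial (true ∷ S)    (true ∷ x)    = monomial S x

-- A multilinear polynomial in x_1..x_n is given by its coefficient function
-- S ↦ c_S on subsets S ⊆ [n]; coefficients are natural numbers read mod 2^k.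
Poly : ℕ → Set
Poly n = Vec Bool n → ℕ

DegLe : {n : ℕ} → ℕ → ℕ → Poly n → Set
DegLe {n} k d c = (S : Vec Bool n) → d < weight S → mod2^ k (c S) ≡ 0

eval : {n : ℕ} → ℕ → Poly n → Vec Bool n → ℕ
eval {n} k c x = mod2^ k (sum (map (λ S → c S * monomial S x) (cube n)))

countAgree : {n : ℕ} → (Vec Bool n → ℕ) → (Vec Bool n → ℕ) → List (Vec Bool n) → ℕ
countAgree f g []       = 0
countAgree f g (x ∷ xs) = (if f x ≡ᵇ g x then 1 else 0) + countAgree f g xs

-- 2^n · agr(Maj_{n,k}, Q) : the number of x ∈ {0,1}^n with (Maj_n)_k(x) = Q(x) in Z/2^k.
agreements : (n k : ℕ) → Poly n → ℕ
agreements n k c = countAgree (λ x → mod2^ k (lift k (Maj n x))) (eval k c) (cube n)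

{-# OPTIONS --safe #-}

-- Let E be the agreement set of Q with 2^(k-1)·Maj and r = ⌊n/2⌋. We show |E| ≤ Σ_{i<d+r+2} C(n,i),
-- which exceeds 2^(n-1) by O(d) middle binomial coefficients, each at most 2^n/√n.
-- If E were larger, Gaussian elimination would give a nonzero w : E → ℤ orthogonal to every integer
-- polynomial of degree at most d + r + 1. Orthogonality to Q·B for B of degree at most r says
-- 2^k ∣ 2^(k-1) Σ w·Maj·B, so Σ w·Maj·B is even, and then so is Σ w·(1-Maj)·B. A function on the
-- light half of the cube is determined by its pairings with the monomials B = x^S, |S| ≤ r, and on
-- the heavy half by those with B = (1-x)^S, so every value of w is even. Then w/2 is orthogonal to
-- the same polynomials, and infinite descent gives w = 0.

module Submission where

open import Defs

-- Binomial coefficients and their partial sums.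

module Binomial where

  open import Data.Nat
  open import Data.Nat.Combinatorics using (_C_; nC1≡n; nCk+nC[k+1]≡[n+1]C[k+1])
  open import Data.Nat.Properties
  open import Data.Nat.Tactic.RingSolver using (solve-∀)
  open import Data.Product using (∃; _,_)
  open import Relation.Binary.PropositionalEquality using (_≡_; refl; sym; trans; cong; cong₂; subst)

  open ≤-Reasoning

  -- binomialSum n e = Σ_{i<e} C(n,i), by Pascal's rule.
  binomialSum : ℕ → ℕ → ℕ
  binomialSum n       zero    = 0
  binomialSum zero    (suc e) = 1
  binomialSum (suc n) (suc e) = binomialSum n (suc e) + binomialSum n e

  -- Identifies the recursively defined sum with the partial row sum: the inductive hypothesis is
  -- applied to both summands, and the two last coefficients merge by Pascal's rule.
  binomialSum-suc : ∀ n e → binomialSum n (suc e) ≡ binomialSum n e + n C e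
  binomialSum-suc zero    zero    = refl
  binomialSum-suc zero    (suc e) = refl
  binomialSum-suc (suc n) zero    = trans (+-identityʳ _) (binomialSum-suc n 0)
  binomialSum-suc (suc n) (suc e) = begin-equality
    binomialSum n (2 + e) + binomialSum n (suc e)
      ≡⟨ cong₂ _+_ (binomialSum-suc n (suc e)) (binomialSum-suc n e) ⟩
    (binomialSum n (suc e) + n C suc e) + (binomialSum n e + n C e)
      ≡⟨ rearrange (binomialSum n (suc e)) (n C suc e) (binomialSum n e) (n C e) ⟩
    (binomialSum n (suc e) + binomialSum n e) + (n C e + n C suc e)
      ≡⟨ cong (binomialSum (suc n) (suc e) +_) (nCk+nC[k+1]≡[n+1]C[k+1] n e) ⟩
    binomialSum (suc n) (suc e) + suc n C suc e ∎
    where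
    rearrange : ∀ a b c d → (a + b) + (c + d) ≡ (a + c) + (d + b)
    rearrange = solve-∀

  -- (j+1) C(n,j+1) = (n-j) C(n,j), without the subtraction.
  C-absorb : ∀ n j → suc j * (n C suc j) + j * (n C j) ≡ n * (n C j)
  C-absorb zero    zero    = refl
  C-absorb zero    (suc j) = cong₂ _+_ (*-zeroʳ (2 + j)) (*-zeroʳ (suc j))
  C-absorb (suc n) zero    = trans (+-identityʳ _) (trans (*-identityˡ _)
    (trans (nC1≡n (suc n)) (sym (*-identityʳ _))))
  C-absorb (suc n) (suc j) = begin-equality
    (2 + j) * (suc n C (2 + j)) + suc j * (suc n C suc j)
      ≡⟨ cong₂ (λ u v → (2 + j) * u + suc j * v)
           (sym (nCk+nC[k+1]≡[n+1]C[k+1] n (suc j))) (sym (nCk+nC[k+1]≡[n+1]C[k+1] n j)) ⟩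
    (2 + j) * (b + c) + suc j * (a + b)
      ≡⟨ split j a b c ⟩
    (suc j * b + j * a) + ((2 + j) * c + suc j * b) + (a + b)
      ≡⟨ cong₂ (λ u v → u + v + (a + b)) (C-absorb n j) (C-absorb n (suc j)) ⟩
    n * a + n * b + (a + b)
      ≡⟨ collect n a b ⟩
    suc n * (a + b)
      ≡⟨ cong (suc n *_) (nCk+nC[k+1]≡[n+1]C[k+1] n j) ⟩
    suc n * (suc n C suc j) ∎
    where
    a = n C j
    b = n C suc j
    c = n C (2 + j)
    split : ∀ j a b c → (2 + j) * (b + c) + (1 + j) * (a + b)
          ≡ ((1 + j) * b + j * a) + ((2 + j) * c + (1 + j) * b) + (a + b)
    split = solve-∀
    collect : ∀ n a b → n * a + n * b + (a + b) ≡ (1 + n) * (a + b)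
    collect = solve-∀

  odd-*-split : ∀ j a → (1 + j * 2) * a ≡ (1 + j) * a + j * a
  odd-*-split = solve-∀

  -- By absorption, passing from index j to j+1 multiplies the coefficient by (n-j)/(j+1), and n ≤
  -- 2j+1 makes this ratio at most 1.
  C-decreasing : ∀ {n} j → n ≤ suc (j * 2) → n C suc j ≤ n C j
  C-decreasing {n} j n≤ = *-cancelˡ-≤ (suc j) (+-cancelʳ-≤ (j * (n C j)) _ _ (begin
    suc j * (n C suc j) + j * (n C j) ≡⟨ C-absorb n j ⟩
    n * (n C j)                       ≤⟨ *-monoˡ-≤ (n C j) n≤ ⟩
    suc (j * 2) * (n C j)             ≡⟨ odd-*-split j (n C j) ⟩
    suc j * (n C j) + j * (n C j)     ∎))

  -- For n = 2m+1 and j = m the absorption ratio is exactly 1.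
  C-odd-middle : ∀ m → suc (m * 2) C suc m ≡ suc (m * 2) C m
  C-odd-middle m = *-cancelˡ-≡ _ _ (suc m) (+-cancelʳ-≡ (m * (suc (m * 2) C m)) _ _
    (trans (C-absorb (suc (m * 2)) m) (odd-*-split m (suc (m * 2) C m))))

  -- Pascal followed by absorption in row 2m. Together with `C-central-suc` it gives the ratio
  -- 2(2m+1)/(m+1) between consecutive central coefficients.
  C-even-middle : ∀ m → suc m * (suc (m * 2) C suc m) ≡ suc (m * 2) * ((m * 2) C m)
  C-even-middle m = begin-equality
    suc m * (suc (m * 2) C suc m)
      ≡⟨ cong (suc m *_) (sym (nCk+nC[k+1]≡[n+1]C[k+1] (m * 2) m)) ⟩
    suc m * (c + c′)
      ≡⟨ split m c c′ ⟩
    (suc m * c′ + m * c) + c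
      ≡⟨ cong (_+ c) (C-absorb (m * 2) m) ⟩
    m * 2 * c + c
      ≡⟨ +-comm (m * 2 * c) c ⟩
    suc (m * 2) * c ∎
    where
    c = (m * 2) C m
    c′ = (m * 2) C suc m
    split : ∀ m c c′ → (1 + m) * (c + c′) ≡ ((1 + m) * c′ + m * c) + c
    split = solve-∀

  C-central-suc : ∀ m → (suc m * 2) C suc m ≡ 2 * (suc (m * 2) C suc m)
  C-central-suc m = begin-equality
    (suc m * 2) C suc m
      ≡⟨ sym (nCk+nC[k+1]≡[n+1]C[k+1] (suc (m * 2)) m) ⟩
    suc (m * 2) C m + suc (m * 2) C suc m
      ≡⟨ cong (_+ suc (m * 2) C suc m) (sym (C-odd-middle m)) ⟩
    suc (m * 2) C suc m + suc (m * 2) C suc m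
      ≡⟨ cong (suc (m * 2) C suc m +_) (sym (+-identityʳ _)) ⟩
    2 * (suc (m * 2) C suc m) ∎

  -- The square-root-free form of C(2m,m) ≤ 4^m / √(2m+1). In the induction the ratio of consecutive
  -- central coefficients reduces the claim to (2m+3)(2m+1) ≤ (2m+2)^2.
  central-bound : ∀ m → suc (m * 2) * ((m * 2) C m) ^ 2 ≤ (2 ^ (m * 2)) ^ 2
  central-bound zero    = ≤-refl
  central-bound (suc m) = *-cancelˡ-≤ (suc m ^ 2) {{m^n≢0 (suc m) 2}} (begin
    suc m ^ 2 * (suc (suc m * 2) * ((suc m * 2) C suc m) ^ 2)
      ≡⟨ cong (λ z → suc m ^ 2 * (suc (suc m * 2) * z ^ 2)) (C-central-suc m) ⟩
    suc m ^ 2 * ((3 + m * 2) * (2 * g) ^ 2)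
      ≡⟨ regroup m g ⟩
    (3 + m * 2) * 4 * (suc m * g) ^ 2
      ≡⟨ cong (λ z → (3 + m * 2) * 4 * z ^ 2) (C-even-middle m) ⟩
    (3 + m * 2) * 4 * (suc (m * 2) * c) ^ 2
      ≡⟨ regroup′ m c ⟩
    (3 + m * 2) * 4 * suc (m * 2) * (suc (m * 2) * c ^ 2)
      ≤⟨ *-monoʳ-≤ ((3 + m * 2) * 4 * suc (m * 2)) (central-bound m) ⟩
    (3 + m * 2) * 4 * suc (m * 2) * p ^ 2
      -- (2m+3)(2m+1) falls short of (2m+2)^2 by exactly 1; after the factor 4 the missing amount is
      -- 4p^2.
      ≤⟨ m≤m+n _ (4 * p ^ 2) ⟩
    (3 + m * 2) * 4 * suc (m * 2) * p ^ 2 + 4 * p ^ 2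
      ≡⟨ regroup″ m p ⟩
    suc m ^ 2 * (2 ^ (suc m * 2)) ^ 2 ∎)
    where
    c = (m * 2) C m
    g = suc (m * 2) C suc m
    p = 2 ^ (m * 2)
    regroup : ∀ m g → (1 + m) * ((1 + m) * 1) * ((3 + m * 2) * ((2 * g) * ((2 * g) * 1)))
            ≡ (3 + m * 2) * 4 * (((1 + m) * g) * (((1 + m) * g) * 1))
    regroup = solve-∀
    regroup′ : ∀ m c → (3 + m * 2) * 4 * (((1 + m * 2) * c) * (((1 + m * 2) * c) * 1))
             ≡ (3 + m * 2) * 4 * (1 + m * 2) * ((1 + m * 2) * (c * (c * 1)))
    regroup′ = solve-∀
    regroup″ : ∀ m p → (3 + m * 2) * 4 * (1 + m * 2) * (p * (p * 1)) + 4 * (p * (p * 1))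
             ≡ (1 + m) * ((1 + m) * 1) * ((2 * (2 * p)) * ((2 * (2 * p)) * 1))
    regroup″ = solve-∀

  -- C(2m+1,m) is half of C(2m+2,m+1), so the central bound at m+1 applies.
  odd-middle-bound : ∀ m → suc (m * 2) * (suc (m * 2) C m) ^ 2 ≤ (2 ^ suc (m * 2)) ^ 2
  odd-middle-bound m = *-cancelˡ-≤ 4 (begin
    4 * (suc (m * 2) * (suc (m * 2) C m) ^ 2)
      ≡⟨ cong (λ z → 4 * (suc (m * 2) * z ^ 2)) (sym (C-odd-middle m)) ⟩
    4 * (suc (m * 2) * g ^ 2)
      ≡⟨ regroup m g ⟩
    suc (m * 2) * (2 * g) ^ 2
      ≡⟨ cong (λ z → suc (m * 2) * z ^ 2) (sym (C-central-suc m)) ⟩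
    suc (m * 2) * ((suc m * 2) C suc m) ^ 2
      ≤⟨ *-monoˡ-≤ (((suc m * 2) C suc m) ^ 2) (m≤n+m (suc (m * 2)) 2) ⟩
    suc (suc m * 2) * ((suc m * 2) C suc m) ^ 2
      ≤⟨ central-bound (suc m) ⟩
    (2 ^ (suc m * 2)) ^ 2
      ≡⟨ regroup′ (2 ^ suc (m * 2)) ⟩
    4 * (2 ^ suc (m * 2)) ^ 2 ∎)
    where
    g = suc (m * 2) C suc m
    regroup : ∀ m g → 4 * ((1 + m * 2) * (g * (g * 1))) ≡ (1 + m * 2) * ((2 * g) * ((2 * g) * 1))
    regroup = solve-∀
    regroup′ : ∀ p → (2 * p) * ((2 * p) * 1) ≡ 4 * (p * (p * 1))
    regroup′ = solve-∀

  -- Half of an odd row sums to half of 2^(2m+1). Two uses of Pascal express the sum for row 2m+3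
  -- through row 2m+1, where equality of the two middle coefficients collapses it to four times the
  -- previous value.
  binomialSum-odd : ∀ m → binomialSum (suc (m * 2)) (suc m) ≡ 2 ^ (m * 2)
  binomialSum-odd zero    = refl
  binomialSum-odd (suc m) = begin-equality
    (S (2 + m) + S (suc m)) + (S (suc m) + S m)
      ≡⟨ cong (λ z → (z + S (suc m)) + (S (suc m) + S m)) (binomialSum-suc n (suc m)) ⟩
    ((S (suc m) + n C suc m) + S (suc m)) + (S (suc m) + S m)
      ≡⟨ cong (λ z → ((S (suc m) + z) + S (suc m)) + (S (suc m) + S m)) (C-odd-middle m) ⟩
    ((S (suc m) + n C m) + S (suc m)) + (S (suc m) + S m)
      ≡⟨ regroup (S (suc m)) (n C m) (S m) ⟩
    3 * S (suc m) + (S m + n C m)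
      ≡⟨ cong (3 * S (suc m) +_) (sym (binomialSum-suc n m)) ⟩
    3 * S (suc m) + S (suc m)
      ≡⟨ regroup′ (S (suc m)) ⟩
    2 * (2 * S (suc m))
      ≡⟨ cong (λ z → 2 * (2 * z)) (binomialSum-odd m) ⟩
    2 ^ (suc m * 2) ∎
    where
    n = suc (m * 2)
    S = binomialSum n
    regroup : ∀ s a t → ((s + a) + s) + (s + t) ≡ 3 * s + (t + a)
    regroup = solve-∀
    regroup′ : ∀ s → 3 * s + s ≡ 2 * (2 * s)
    regroup′ = solve-∀

  -- Partial sums slightly beyond the middle of a row.

  data Half : ℕ → ℕ → Set where
    even : ∀ m → Half (m * 2) m
    odd  : ∀ m → Half (suc (m * 2)) m

  half : ∀ n → ∃ (Half n)
  half zero          = 0 , even 0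
  half (suc zero)    = 0 , odd 0
  half (suc (suc n)) with half n
  ... | m , even .m = suc m , even (suc m)
  ... | m , odd .m  = suc m , odd (suc m)

  Half⇒≤ : ∀ {n m} → Half n m → n ≤ suc (m * 2)
  Half⇒≤ (even m) = n≤1+n _
  Half⇒≤ (odd m) = ≤-refl

  Half⇒≥ : ∀ {n m} → Half n m → m * 2 ≤ n
  Half⇒≥ (even m) = ≤-refl
  Half⇒≥ (odd m) = n≤1+n _

  middle-bound : ∀ {n m} → Half n m → n * (n C m) ^ 2 ≤ (2 ^ n) ^ 2
  middle-bound (even m) =
    ≤-trans (*-monoˡ-≤ (((m * 2) C m) ^ 2) (n≤1+n (m * 2))) (central-bound m)
  middle-bound (odd m) = odd-middle-bound m

  -- In an even row, doubling the sum and splitting off the middle term once leaves, by Pascal, half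
  -- of row 2m+1, which is 2^(2m). In an odd row the sum is already half of 2^n.
  binomialSum-half : ∀ {n m} → Half n m → 2 * binomialSum n (suc m) ≤ 2 ^ n + n C m
  binomialSum-half (even m) = ≤-reflexive (begin-equality
    2 * S (suc m)              ≡⟨ cong (S (suc m) +_) (+-identityʳ _) ⟩
    S (suc m) + S (suc m)      ≡⟨ cong (S (suc m) +_) (binomialSum-suc (m * 2) m) ⟩
    S (suc m) + (S m + (m * 2) C m) ≡⟨ sym (+-assoc (S (suc m)) (S m) _) ⟩
    S (suc m) + S m + (m * 2) C m ≡⟨ cong (_+ (m * 2) C m) (binomialSum-odd m) ⟩
    2 ^ (m * 2) + (m * 2) C m  ∎)
    where S = binomialSum (m * 2)
  binomialSum-half (odd m) =
    ≤-trans (≤-reflexive (cong (2 *_) (binomialSum-odd m))) (m≤m+n _ _)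

  C-above-middle : ∀ {n m} → Half n m → ∀ i → n C (i + m) ≤ n C m
  C-above-middle         h zero    = ≤-refl
  C-above-middle {m = m} h (suc i) = ≤-trans
    (C-decreasing (i + m) (≤-trans (Half⇒≤ h) (s≤s (*-monoˡ-≤ 2 (m≤n+m m i)))))
    (C-above-middle h i)

  -- Each of the i terms past the middle is at most the middle coefficient, and doubling counts it
  -- twice.
  binomialSum-above-half : ∀ {n m} → Half n m → ∀ i →
    2 * binomialSum n (i + suc m) ≤ 2 ^ n + suc (i * 2) * (n C m)
  binomialSum-above-half {n} {m} h zero =
    ≤-trans (binomialSum-half h) (+-monoʳ-≤ (2 ^ n) (m≤m+n (n C m) 0))
  binomialSum-above-half {n} {m} h (suc i) = begin
    2 * binomialSum n (suc (i + suc m))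
      ≡⟨ cong (2 *_) (binomialSum-suc n (i + suc m)) ⟩
    2 * (binomialSum n (i + suc m) + n C (i + suc m))
      ≡⟨ *-distribˡ-+ 2 (binomialSum n (i + suc m)) _ ⟩
    2 * binomialSum n (i + suc m) + 2 * (n C (i + suc m))
      ≤⟨ +-mono-≤ (binomialSum-above-half h i) (*-monoʳ-≤ 2
           (subst (λ j → n C j ≤ n C m) (sym (+-suc i m)) (C-above-middle h (suc i)))) ⟩
    2 ^ n + suc (i * 2) * (n C m) + 2 * (n C m)
      ≡⟨ collect (2 ^ n) i (n C m) ⟩
    2 ^ n + suc (suc i * 2) * (n C m) ∎
    where
    collect : ∀ p i c → p + (1 + i * 2) * c + 2 * c ≡ p + (3 + i * 2) * c
    collect = solve-∀

  -- With d+1 extra terms the excess is at most 2d+3 middle coefficients; squaring allows the bound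
  -- 2^n/√n on that coefficient to enter without roots.
  excess-bound : ∀ {n m} → Half n m → ∀ d A → 1 ≤ d → A ≤ binomialSum n (suc d + suc m) →
    n * (2 * A ∸ 2 ^ n) ^ 2 ≤ 400 * d ^ 2 * (2 ^ n) ^ 2
  excess-bound {n} {m} h d A 1≤d A≤ = begin
    n * (2 * A ∸ 2 ^ n) ^ 2
      ≤⟨ *-monoʳ-≤ n (^-monoˡ-≤ 2 excess) ⟩
    n * (5 * d * (n C m)) ^ 2
      ≡⟨ regroup n d (n C m) ⟩
    25 * d ^ 2 * (n * (n C m) ^ 2)
      -- The argument yields 25 = 5^2; it is relaxed to 400 = 25 + 375.
      ≤⟨ *-mono-≤ (*-monoˡ-≤ (d ^ 2) (m≤m+n 25 375)) (middle-bound h) ⟩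
    400 * d ^ 2 * (2 ^ n) ^ 2 ∎
    where
    regroup : ∀ n d c → n * ((5 * d * c) * ((5 * d * c) * 1)) ≡ 25 * (d * (d * 1)) * (n * (c * (c * 1)))
    regroup = solve-∀
    -- This is where 1 ≤ d enters: the constant 3 is absorbed into 3d.
    five : suc (suc d * 2) ≤ 5 * d
    five = begin
      3 + d * 2     ≤⟨ +-monoˡ-≤ (d * 2) (*-monoʳ-≤ 3 1≤d) ⟩
      3 * d + d * 2 ≡⟨ sum-five d ⟩
      5 * d         ∎
      where
      sum-five : ∀ d → 3 * d + d * 2 ≡ 5 * d
      sum-five = solve-∀
    excess : 2 * A ∸ 2 ^ n ≤ 5 * d * (n C m)
    excess = begin
      2 * A ∸ 2 ^ n ≤⟨ ∸-monoˡ-≤ (2 ^ n) (≤-trans (*-monoʳ-≤ 2 A≤) (binomialSum-above-half h (suc d))) ⟩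
      2 ^ n + suc (suc d * 2) * (n C m) ∸ 2 ^ n ≡⟨ m+n∸m≡n (2 ^ n) _ ⟩
      suc (suc d * 2) * (n C m) ≤⟨ *-monoˡ-≤ (n C m) five ⟩
      5 * d * (n C m) ∎

module Cube where

  open import Data.Bool using (Bool; true; false; not)
  import Data.Bool as Bool
  open import Data.Bool.Properties using (T?; T-≡; not-involutive)
  open import Data.Empty using (⊥; ⊥-elim)
  open import Data.Integer using (ℤ; +_; -_; _+_; _-_; _*_; ∣_∣; 0ℤ; 1ℤ; -1ℤ)
  open import Data.Integer.Divisibility.Signed
  open import Data.Integer.Properties hiding (_≟_)
  open import Data.Integer.Properties using () renaming (_≟_ to _≟ᶻ_)
  open import Data.Integer.Tactic.RingSolver using (solve-∀)
  open import Data.List using (List; []; _∷_; map; _++_; length; filterᵇ)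
  open import Data.List.Membership.Propositional using (_∈_; find)
  open import Data.List.Membership.Propositional.Properties
    using (∈-map⁺; ∈-map⁻; ∈-++⁺ˡ; ∈-++⁺ʳ; ∈-filter⁻)
  open import Data.List.Properties using (length-map; length-++)
  open import Data.List.Relation.Binary.Permutation.Propositional
    using (_↭_; prep; swap; ↭-refl; ↭-trans; ↭-sym)
  open import Data.List.Relation.Binary.Permutation.Propositional.Properties using (All-resp-↭; ↭-length)
  open import Data.List.Relation.Unary.All as All using (All; []; _∷_)
  import Data.List.Relation.Unary.All.Properties as All
  open import Data.List.Relation.Unary.AllPairs using ([]; _∷_)
  open import Data.List.Relation.Unary.Any using (Any; here; there)
  open import Data.List.Relation.Unary.Unique.Propositional using (Unique)
  import Data.List.Relation.Unary.Unique.Propositional.Properties as Unique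
  open import Data.Nat as ℕ using (ℕ; zero; suc)
  import Data.Nat.DivMod as ℕ
  open import Data.Nat.ListAction using (sum)
  import Data.Nat.Properties as ℕ
  open import Data.Product using (∃; ∃₂; _×_; _,_; proj₁; proj₂)
  open import Data.Sum using (_⊎_; inj₁; inj₂; [_,_]′)
  open import Data.Vec as Vec using (Vec; []; _∷_)
  import Data.Vec.Properties as Vec
  open import Function using (_∘_; Equivalence)
  open import Relation.Binary.Definitions using (DecidableEquality)
  open import Relation.Binary.PropositionalEquality
  open import Relation.Nullary using (yes; no)
  open Binomial using (binomialSum)

  open ≡-Reasoning

  -- Finite sums of integers.

  ∑ : {A : Set} → List A → (A → ℤ) → ℤ
  ∑ []       f = 0ℤ
  ∑ (x ∷ xs) f = f x + ∑ xs f

  module _ {A : Set} where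

    ∑-cong-∈ : ∀ xs {f g : A → ℤ} → (∀ {x} → x ∈ xs → f x ≡ g x) → ∑ xs f ≡ ∑ xs g
    ∑-cong-∈ []       eq = refl
    ∑-cong-∈ (x ∷ xs) eq = cong₂ _+_ (eq (here refl)) (∑-cong-∈ xs (eq ∘ there))

    ∑-cong : ∀ xs {f g : A → ℤ} → (∀ x → f x ≡ g x) → ∑ xs f ≡ ∑ xs g
    ∑-cong xs eq = ∑-cong-∈ xs (λ {x} _ → eq x)

    ∑-linear : ∀ xs (f g : A → ℤ) a b →
      ∑ xs (λ x → a * f x + b * g x) ≡ a * ∑ xs f + b * ∑ xs g
    ∑-linear []       f g a b = sym (cong₂ _+_ (*-zeroʳ a) (*-zeroʳ b))
    ∑-linear (x ∷ xs) f g a b = trans (cong (_+_ (a * f x + b * g x)) (∑-linear xs f g a b))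
      (regroup a b (f x) (g x) (∑ xs f) (∑ xs g))
      where
      regroup : ∀ a b u v s t → (a * u + b * v) + (a * s + b * t) ≡ a * (u + s) + b * (v + t)
      regroup = solve-∀

    ∑-+ : ∀ xs (f g : A → ℤ) → ∑ xs (λ x → f x + g x) ≡ ∑ xs f + ∑ xs g
    ∑-+ xs f g = begin
      ∑ xs (λ x → f x + g x)
        ≡⟨ ∑-cong xs (λ x → cong₂ _+_ (sym (*-identityˡ (f x))) (sym (*-identityˡ (g x)))) ⟩
      ∑ xs (λ x → 1ℤ * f x + 1ℤ * g x)
        ≡⟨ ∑-linear xs f g 1ℤ 1ℤ ⟩
      1ℤ * ∑ xs f + 1ℤ * ∑ xs g
        ≡⟨ cong₂ _+_ (*-identityˡ (∑ xs f)) (*-identityˡ (∑ xs g)) ⟩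
      ∑ xs f + ∑ xs g ∎

    ∑-* : ∀ xs (f : A → ℤ) a → ∑ xs (λ x → a * f x) ≡ a * ∑ xs f
    ∑-* []       f a = sym (*-zeroʳ a)
    ∑-* (x ∷ xs) f a = trans (cong (_+_ (a * f x)) (∑-* xs f a)) (sym (*-distribˡ-+ a (f x) (∑ xs f)))

    ∑-0 : ∀ xs {f : A → ℤ} → (∀ x → f x ≡ 0ℤ) → ∑ xs f ≡ 0ℤ
    ∑-0 []       eq = refl
    ∑-0 (x ∷ xs) eq = cong₂ _+_ (eq x) (∑-0 xs eq)

    ∑-∣ : ∀ {m} xs {f : A → ℤ} → (∀ x → m ∣ f x) → m ∣ ∑ xs f
    ∑-∣ []       m∣f = divides 0ℤ refl
    ∑-∣ (x ∷ xs) m∣f = ∣m∣n⇒∣m+n (m∣f x) (∑-∣ xs m∣f)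

    -- All other terms can be subtracted from the sum. Uniqueness ensures that they sit at points
    -- different from x.
    ∑-∣-term : ∀ {m xs} {f : A → ℤ} {x} → Unique xs → x ∈ xs →
      (∀ y → y ≢ x → m ∣ f y) → m ∣ ∑ xs f → m ∣ f x
    ∑-∣-term {f = f} (x∉xs ∷ u) (here refl) m∣f m∣∑ = ∣m+n∣n⇒∣m m∣∑ (rest x∉xs)
      where
      rest : ∀ {xs} → All (_ ≢_) xs → _ ∣ ∑ xs f
      rest []            = divides 0ℤ refl
      rest (x≢y ∷ x∉ys) = ∣m∣n⇒∣m+n (m∣f _ (x≢y ∘ sym)) (rest x∉ys)
    ∑-∣-term {f = f} (y∉xs ∷ u) (there x∈xs) m∣f m∣∑ =
      ∑-∣-term u x∈xs m∣f (∣m+n∣m⇒∣n m∣∑ (m∣f _ (All.lookup y∉xs x∈xs)))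

    ∑-++ : ∀ xs ys (f : A → ℤ) → ∑ (xs ++ ys) f ≡ ∑ xs f + ∑ ys f
    ∑-++ []       ys f = sym (+-identityˡ _)
    ∑-++ (x ∷ xs) ys f = trans (cong (_+_ (f x)) (∑-++ xs ys f)) (sym (+-assoc (f x) _ _))

    ∑-map : ∀ {B : Set} (h : B → A) xs (f : A → ℤ) → ∑ (map h xs) f ≡ ∑ xs (f ∘ h)
    ∑-map h []       f = refl
    ∑-map h (x ∷ xs) f = cong (_+_ (f (h x))) (∑-map h xs f)

  χ : Bool → ℤ
  χ false = 0ℤ
  χ true  = 1ℤ

  ∑-filter : ∀ {A : Set} (p : A → Bool) xs (f : A → ℤ) →
    ∑ (filterᵇ p xs) f ≡ ∑ xs (λ x → χ (p x) * f x)
  ∑-filter p []       f = refl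
  ∑-filter p (x ∷ xs) f with p x
  ... | true  = cong₂ _+_ (sym (*-identityˡ (f x))) (∑-filter p xs f)
  ... | false = trans (∑-filter p xs f) (sym (+-identityˡ _))

  -- Gaussian elimination over the integers.

  module Elimination {A : Set} (_≟_ : DecidableEquality A) where

    _[_↦_] : (A → ℤ) → A → ℤ → A → ℤ
    (v [ x ↦ a ]) y with y ≟ x
    ... | yes _ = a
    ... | no  _ = v y

    update-same : ∀ v x a → (v [ x ↦ a ]) x ≡ a
    update-same v x a with x ≟ x
    ... | yes _  = refl
    ... | no x≢x = ⊥-elim (x≢x refl)

    update-other : ∀ v {x y} a → y ≢ x → (v [ x ↦ a ]) y ≡ v y
    update-other v {x} {y} a y≢x with y ≟ x
    ... | yes y≡x = ⊥-elim (y≢x y≡x)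
    ... | no _    = refl

    ∑-update : ∀ {x xs} → All (x ≢_) xs → ∀ v a (r : A → ℤ) →
      ∑ (x ∷ xs) (λ y → (v [ x ↦ a ]) y * r y) ≡ a * r x + ∑ xs (λ y → v y * r y)
    ∑-update {x} {xs} x∉xs v a r = cong₂ _+_
      (cong (_* r x) (update-same v x a))
      (∑-cong-∈ xs λ {y} y∈xs →
        cong (_* r y) (update-other v a (All.lookup x∉xs y∈xs ∘ sym)))

    pivot : ∀ x (rows : List (A → ℤ)) →
      All (λ r → r x ≡ 0ℤ) rows ⊎ ∃₂ λ r rest → r x ≢ 0ℤ × rows ↭ r ∷ rest
    pivot x []         = inj₁ []
    pivot x (s ∷ rows) with s x ≟ᶻ 0ℤ | pivot x rows
    ... | no  sx≢0 | _         = inj₂ (s , rows , sx≢0 , ↭-refl)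
    ... | yes sx≡0 | inj₁ zs   = inj₁ (sx≡0 ∷ zs)
    ... | yes sx≡0 | inj₂ (r , rest , rx≢0 , perm) =
      inj₂ (r , s ∷ rest , rx≢0 , ↭-trans (prep s perm) (swap s r ↭-refl))

    -- Induction on the unknowns. If every row vanishes at x, the unit vector at x is a solution.
    -- Otherwise a pivot row clears x from the remaining rows, leaving one unknown and one equation
    -- fewer.
    nontrivial-solution : ∀ {xs} → Unique xs → (rows : List (A → ℤ)) → length rows ℕ.< length xs →
      ∃ λ (w : A → ℤ) → Any (λ x → w x ≢ 0ℤ) xs × All (λ r → ∑ xs (λ x → w x * r x) ≡ 0ℤ) rows
    nontrivial-solution {x ∷ xs} (x∉xs ∷ u) rows (ℕ.s≤s rows≤xs) with pivot x rows
    ... | inj₁ zs =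
      (λ _ → 0ℤ) [ x ↦ 1ℤ ] ,
      here (λ eq → 1≢0 (trans (sym (update-same _ x 1ℤ)) eq)) ,
      All.map (λ {r} rx≡0 → trans (∑-update x∉xs (λ _ → 0ℤ) 1ℤ r)
        (cong₂ _+_ (cong (1ℤ *_) rx≡0) (∑-0 xs (λ y → refl)))) zs
      where
      1≢0 : 1ℤ ≢ 0ℤ
      1≢0 ()
    ... | inj₂ (r , rest , rx≢0 , perm) =
      w , there (nonzero x∉xs v≢0) ,
      All-resp-↭ (↭-sym perm) (w·r≡0 ∷ All.map (λ {s} → w·s≡0 {s}) (All.map⁻ v·rest≡0))
      where
      -- Cross-multiplication with the pivot row cancels the entry at x without division.
      reduce : (A → ℤ) → A → ℤ
      reduce s y = r x * s y + - s x * r y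

      rest<xs : length (map reduce rest) ℕ.< length xs
      rest<xs = subst₂ ℕ._≤_ (trans (↭-length perm) (cong suc (sym (length-map reduce rest)))) refl rows≤xs

      solution = nontrivial-solution u (map reduce rest) rest<xs

      v = proj₁ solution
      v≢0 = proj₁ (proj₂ solution)
      v·rest≡0 = proj₂ (proj₂ solution)

      v·_ : (A → ℤ) → ℤ
      v· s = ∑ xs (λ y → v y * s y)

      -- Scaling v by the pivot r x keeps the back-substituted value at x integral. It gives w·r =
      -- 0, and w·s = v·(reduce s) for every other row s.
      w : A → ℤ
      w = (λ y → r x * v y) [ x ↦ - (v· r) ]

      nonzero : ∀ {ys} → All (x ≢_) ys → Any (λ y → v y ≢ 0ℤ) ys → Any (λ y → w y ≢ 0ℤ) ys
      nonzero (x≢y ∷ _) (here {y} vy≢0) = here λ wy≡0 →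
        [ rx≢0 , vy≢0 ]′ (i*j≡0⇒i≡0∨j≡0 (r x) (trans (sym (update-other _ _ (x≢y ∘ sym))) wy≡0))
      nonzero (_ ∷ x∉ys) (there any) = there (nonzero x∉ys any)

      w·_ : ∀ s → ∑ (x ∷ xs) (λ y → w y * s y) ≡ - (v· r) * s x + r x * (v· s)
      w· s = trans (∑-update x∉xs (λ y → r x * v y) (- (v· r)) s)
        (cong (_+_ (- (v· r) * s x)) (trans (∑-cong xs (λ y → *-assoc (r x) (v y) (s y))) (∑-* xs _ (r x))))

      w·r≡0 : ∑ (x ∷ xs) (λ y → w y * r y) ≡ 0ℤ
      w·r≡0 = trans (w· r) (cancel (v· r) (r x))
        where
        cancel : ∀ a b → - a * b + b * a ≡ 0ℤ
        cancel = solve-∀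

      w·s≡0 : ∀ {s} → v· reduce s ≡ 0ℤ → ∑ (x ∷ xs) (λ y → w y * s y) ≡ 0ℤ
      w·s≡0 {s} eq = begin
        ∑ (x ∷ xs) (λ y → w y * s y)
          ≡⟨ w· s ⟩
        - (v· r) * s x + r x * (v· s)
          ≡⟨ regroup (v· r) (s x) (r x) (v· s) ⟩
        r x * (v· s) + - s x * (v· r)
          ≡⟨ sym (∑-linear xs (λ y → v y * s y) (λ y → v y * r y) (r x) (- s x)) ⟩
        ∑ xs (λ y → r x * (v y * s y) + - s x * (v y * r y))
          ≡⟨ ∑-cong xs (λ y → factor (v y) (r x) (s y) (s x) (r y)) ⟩
        v· reduce s
          ≡⟨ eq ⟩
        0ℤ ∎
        where
        regroup : ∀ a b c d → - a * b + c * d ≡ c * d + - b * a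
        regroup = solve-∀
        factor : ∀ v a s b r → a * (v * s) + - b * (v * r) ≡ v * (a * s + - b * r)
        factor = solve-∀

  -- Degree of integer-valued functions on the cube.

  Fun : ℕ → Set
  Fun n = Vec Bool n → ℤ

  Δ : ∀ {n} → Fun (suc n) → Fun n
  Δ f x = f (true ∷ x) - f (false ∷ x)

  -- f has degree < e, read off f = f₀ + x₁ · Δ f with f₀ and Δ f free of x₁.
  data Degree< : ∀ {n} → ℕ → Fun n → Set where
    null  : ∀ {n} {f : Fun n} → (∀ x → f x ≡ 0ℤ) → Degree< zero f
    const : ∀ {e} {f : Fun zero} → Degree< (suc e) f
    split : ∀ {n e} {f : Fun (suc n)} →
            Degree< (suc e) (λ x → f (false ∷ x)) → Degree< e (Δ f) → Degree< (suc e) f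

  deg-resp : ∀ {n e} {f g : Fun n} → (∀ x → f x ≡ g x) → Degree< e f → Degree< e g
  deg-resp eq (null f≡0)  = null λ x → trans (sym (eq x)) (f≡0 x)
  deg-resp eq const       = const
  deg-resp eq (split p q) = split (deg-resp (λ x → eq (false ∷ x)) p)
    (deg-resp (λ x → cong₂ _-_ (eq (true ∷ x)) (eq (false ∷ x))) q)

  deg-0 : ∀ {n} e → Degree< {n} e (λ _ → 0ℤ)
  deg-0         zero    = null λ _ → refl
  deg-0 {zero}  (suc e) = const
  deg-0 {suc n} (suc e) = split (deg-0 (suc e)) (deg-0 e)

  deg-suc : ∀ {n e} {f : Fun n} → Degree< e f → Degree< (suc e) f
  deg-suc (null f≡0)  = deg-resp (λ x → sym (f≡0 x)) (deg-0 1)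
  deg-suc const       = const
  deg-suc (split p q) = split (deg-suc p) (deg-suc q)

  deg-weaken : ∀ {n d e} {f : Fun n} → d ℕ.≤ e → Degree< d f → Degree< e f
  deg-weaken d≤e p = go (ℕ.≤⇒≤′ d≤e) p
    where
    go : ∀ {n d e} {f : Fun n} → d ℕ.≤′ e → Degree< d f → Degree< e f
    go (ℕ.≤′-reflexive refl) p = p
    go (ℕ.≤′-step d≤e)       p = deg-suc (go d≤e p)

  deg-+ : ∀ {n e} {f g : Fun n} → Degree< e f → Degree< e g → Degree< e (λ x → f x + g x)
  deg-+ (null f≡0) (null g≡0) = null λ x → cong₂ _+_ (f≡0 x) (g≡0 x)
  deg-+ const      const      = const
  deg-+ {f = f} {g} (split p q) (split p′ q′) = split (deg-+ p p′)
    (deg-resp (λ x → regroup (f (true ∷ x)) (f (false ∷ x)) (g (true ∷ x)) (g (false ∷ x))) (deg-+ q q′))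
    where
    regroup : ∀ a b c d → (a - b) + (c - d) ≡ (a + c) - (b + d)
    regroup = solve-∀

  deg-scale : ∀ {n e} {f : Fun n} a → Degree< e f → Degree< e (λ x → a * f x)
  deg-scale a (null f≡0) = null λ x → trans (cong (a *_) (f≡0 x)) (*-zeroʳ a)
  deg-scale a const      = const
  deg-scale {f = f} a (split p q) = split (deg-scale a p)
    (deg-resp (λ x → regroup a (f (true ∷ x)) (f (false ∷ x))) (deg-scale a q))
    where
    regroup : ∀ a b c → a * (b - c) ≡ a * b - a * c
    regroup = solve-∀

  -- The discrete Leibniz rule Δ(fg) = f₀ Δg + Δf g₀ + Δf Δg drives the induction. For positive a
  -- and b the bound is one above the sharp one, which is why `suc d + suc r` appears for Q·B later.
  deg-* : ∀ {n a b} {f g : Fun n} → Degree< a f → Degree< b g → Degree< (a ℕ.+ b) (λ x → f x * g x)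
  deg-* {b = b} {g = g} (null f≡0) _ = deg-resp (λ x → sym (cong (_* g x) (f≡0 x))) (deg-0 b)
  deg-* {a = a} {f = f} _ (null g≡0) =
    deg-resp (λ x → sym (trans (cong (f x *_) (g≡0 x)) (*-zeroʳ (f x)))) (deg-0 (a ℕ.+ 0))
  deg-* const const = const
  deg-* {a = suc a} {suc b} {f} {g} (split p q) (split p′ q′) = split (deg-* p p′)
    (deg-resp (λ x → leibniz (f (true ∷ x)) (f (false ∷ x)) (g (true ∷ x)) (g (false ∷ x)))
      (deg-+ (deg-+ (shift (deg-* p q′)) (deg-* q p′)) (shift (deg-suc (deg-* q q′)))))
    where
    shift : ∀ {n} {h : Fun n} → Degree< (suc a ℕ.+ b) h → Degree< (a ℕ.+ suc b) h
    shift {h = h} = subst (λ e → Degree< e h) (sym (ℕ.+-suc a b))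
    leibniz : ∀ f₁ f₀ g₁ g₀ →
      (f₀ * (g₁ - g₀) + (f₁ - f₀) * g₀) + (f₁ - f₀) * (g₁ - g₀) ≡ f₁ * g₁ - f₀ * g₀
    leibniz = solve-∀

  -- Under x ↦ 1-x the lower half f₀ becomes f₀ + Δf and Δf changes sign, up to reflection of the
  -- remaining variables. Hence (1-x)^S has degree at most |S|.
  deg-not : ∀ {n e} {f : Fun n} → Degree< e f → Degree< e (λ x → f (Vec.map not x))
  deg-not (null f≡0) = null λ x → f≡0 _
  deg-not const      = const
  deg-not {f = f} (split p q) = split
    (deg-resp (λ x → telescope (f (false ∷ Vec.map not x)) (f (true ∷ Vec.map not x)))
      (deg-+ (deg-not p) (deg-suc (deg-not q))))
    (deg-resp (λ x → flip (f (true ∷ Vec.map not x)) (f (false ∷ Vec.map not x)))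
      (deg-scale -1ℤ (deg-not q)))
    where
    telescope : ∀ a b → a + (b - a) ≡ b
    telescope = solve-∀
    flip : ∀ a b → -1ℤ * (a - b) ≡ b - a
    flip = solve-∀

  deg-monomial : ∀ {n} (S : Vec Bool n) → Degree< (suc (weight S)) (λ x → + monomial S x)
  deg-monomial []          = const
  deg-monomial (false ∷ S) = split (deg-monomial S)
    (deg-resp (λ x → sym (+-inverseʳ (+ monomial S x))) (deg-0 _))
  deg-monomial (true ∷ S)  = split (deg-0 _)
    (deg-resp (λ x → sym (+-identityʳ (+ monomial S x))) (deg-monomial S))

  deg-sum : ∀ {n e} (a : Vec Bool n → ℕ) → (∀ S → e ℕ.< weight S → a S ≡ 0) → ∀ Ss →
    Degree< (suc e) (λ x → + sum (map (λ S → a S ℕ.* monomial S x) Ss))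
  deg-sum a a≡0 []       = deg-0 _
  deg-sum {e = e} a a≡0 (S ∷ Ss) = deg-resp
    (λ x → sym (pos-+ (a S ℕ.* monomial S x) _))
    (deg-+ (deg-resp (λ x → sym (pos-* (a S) (monomial S x))) term) (deg-sum a a≡0 Ss))
    where
    term : Degree< (suc e) (λ x → + a S * + monomial S x)
    term with e ℕ.<? weight S
    ... | yes e<S = deg-resp (λ x → sym (cong (λ z → + z * + monomial S x) (a≡0 S e<S))) (deg-0 _)
    ... | no  e≮S = deg-scale (+ a S) (deg-weaken (ℕ.s≤s (ℕ.≮⇒≥ e≮S)) (deg-monomial S))

  -- Sums over the cube.

  ∑-cube-suc : ∀ n (f : Fun (suc n)) →
    ∑ (cube (suc n)) f ≡ ∑ (cube n) (λ x → f (false ∷ x)) + ∑ (cube n) (λ x → f (true ∷ x))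
  ∑-cube-suc n f = trans (∑-++ (map (false ∷_) (cube n)) _ f)
    (cong₂ _+_ (∑-map (false ∷_) (cube n) f) (∑-map (true ∷_) (cube n) f))

  ∑-cube-not : ∀ n (f : Fun n) → ∑ (cube n) (λ x → f (Vec.map not x)) ≡ ∑ (cube n) f
  ∑-cube-not zero    f = refl
  ∑-cube-not (suc n) f = begin
    ∑ (cube (suc n)) (λ x → f (Vec.map not x))
      ≡⟨ ∑-cube-suc n (λ x → f (Vec.map not x)) ⟩
    ∑ (cube n) (λ x → f (true ∷ Vec.map not x)) + ∑ (cube n) (λ x → f (false ∷ Vec.map not x))
      ≡⟨ cong₂ _+_ (∑-cube-not n (λ x → f (true ∷ x))) (∑-cube-not n (λ x → f (false ∷ x))) ⟩
    ∑ (cube n) (λ x → f (true ∷ x)) + ∑ (cube n) (λ x → f (false ∷ x))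
      ≡⟨ +-comm (∑ (cube n) (λ x → f (true ∷ x))) _ ⟩
    ∑ (cube n) (λ x → f (false ∷ x)) + ∑ (cube n) (λ x → f (true ∷ x))
      ≡⟨ sym (∑-cube-suc n f) ⟩
    ∑ (cube (suc n)) f ∎

  ∈-cube : ∀ {n} (x : Vec Bool n) → x ∈ cube n
  ∈-cube []          = here refl
  ∈-cube (false ∷ x) = ∈-++⁺ˡ (∈-map⁺ (false ∷_) (∈-cube x))
  ∈-cube (true ∷ x)  = ∈-++⁺ʳ (map (false ∷_) (cube _)) (∈-map⁺ (true ∷_) (∈-cube x))

  cube-unique : ∀ n → Unique (cube n)
  cube-unique zero    = [] ∷ []
  cube-unique (suc n) = Unique.++⁺
    (Unique.map⁺ Vec.∷-injectiveʳ (cube-unique n)) (Unique.map⁺ Vec.∷-injectiveʳ (cube-unique n))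
    λ (x∈₀ , x∈₁) → disjoint (∈-map⁻ (false ∷_) x∈₀) (∈-map⁻ (true ∷_) x∈₁)
    where
    disjoint : ∀ {x : Vec Bool (suc n)} → (∃ λ y → y ∈ cube n × x ≡ false ∷ y) →
      (∃ λ y → y ∈ cube n × x ≡ true ∷ y) → ⊥
    disjoint (_ , _ , refl) (_ , _ , ())

  -- Low-degree monomials and orthogonality.

  extend : ∀ {n} → Fun n → Fun (suc n)
  extend g (_ ∷ x) = g x

  times-head : ∀ {n} → Fun n → Fun (suc n)
  times-head g (false ∷ x) = 0ℤ
  times-head g (true ∷ x)  = g x

  -- The rows of the linear system. Splitting by the presence of x₁ repeats Pascal's rule, so their
  -- number follows the recursion of `binomialSum`.
  monomials< : ∀ n → ℕ → List (Fun n)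
  monomials< n       zero    = []
  monomials< zero    (suc e) = (λ _ → 1ℤ) ∷ []
  monomials< (suc n) (suc e) =
    map extend (monomials< n (suc e)) ++ map times-head (monomials< n e)

  length-monomials< : ∀ n e → length (monomials< n e) ≡ binomialSum n e
  length-monomials< n       zero    = refl
  length-monomials< zero    (suc e) = refl
  length-monomials< (suc n) (suc e) = trans (length-++ (map extend (monomials< n (suc e))))
    (cong₂ ℕ._+_ (trans (length-map extend (monomials< n (suc e))) (length-monomials< n (suc e)))
                 (trans (length-map times-head (monomials< n e)) (length-monomials< n e)))

  infix 4 _⟂_

  _⟂_ : ∀ {n} → Fun n → Fun n → Set
  _⟂_ {n} w f = ∑ (cube n) (λ x → w x * f x) ≡ 0ℤ

  -- Splitting on x₁ gives w·f = (w₀+w₁)·f₀ + w₁·Δf. Orthogonality to monomials free of x₁ passes to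
  -- w₀+w₁, and orthogonality to those containing x₁ passes to w₁, so f is never expanded in a
  -- basis.
  monomials<-span : ∀ {n e} {w f : Fun n} → All (w ⟂_) (monomials< n e) → Degree< e f → w ⟂ f
  monomials<-span {n} {w = w} _ (null f≡0) =
    ∑-0 (cube n) (λ x → trans (cong (w x *_) (f≡0 x)) (*-zeroʳ (w x)))
  monomials<-span {w = w} {f} (w⟂1 ∷ []) const = begin
    w [] * f [] + 0ℤ           ≡⟨ regroup (w []) (f []) ⟩
    (w [] * 1ℤ + 0ℤ) * f []    ≡⟨ cong (_* f []) w⟂1 ⟩
    0ℤ                         ∎
    where
    regroup : ∀ a b → a * b + 0ℤ ≡ (a * 1ℤ + 0ℤ) * b
    regroup = solve-∀
  monomials<-span {suc n} {suc e} {w} {f} w⟂ (split p q) = begin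
    ∑ (cube (suc n)) (λ x → w x * f x)
      ≡⟨ ∑-cube-suc n (λ x → w x * f x) ⟩
    ∑ (cube n) (λ x → w₀ x * f₀ x) + ∑ (cube n) (λ x → w₁ x * f₁ x)
      ≡⟨ sym (∑-+ (cube n) (λ x → w₀ x * f₀ x) (λ x → w₁ x * f₁ x)) ⟩
    ∑ (cube n) (λ x → w₀ x * f₀ x + w₁ x * f₁ x)
      ≡⟨ ∑-cong (cube n) (λ x → regroup (w₀ x) (w₁ x) (f₀ x) (f₁ x)) ⟩
    ∑ (cube n) (λ x → (w₀ x + w₁ x) * f₀ x + w₁ x * Δ f x)
      ≡⟨ ∑-+ (cube n) (λ x → (w₀ x + w₁ x) * f₀ x) (λ x → w₁ x * Δ f x) ⟩
    ∑ (cube n) (λ x → (w₀ x + w₁ x) * f₀ x) + ∑ (cube n) (λ x → w₁ x * Δ f x)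
      ≡⟨ cong₂ _+_
           (monomials<-span {w = λ x → w₀ x + w₁ x} (All.map (λ {g} → ⟂-extend {g}) (All.map⁻ (All.++⁻ˡ _ w⟂))) p)
           (monomials<-span {w = w₁} (All.map (λ {g} → ⟂-times-head {g})
             (All.map⁻ (All.++⁻ʳ (map extend (monomials< n (suc e))) w⟂))) q) ⟩
    0ℤ ∎
    where
    w₀ = λ x → w (false ∷ x)
    w₁ = λ x → w (true ∷ x)
    f₀ = λ x → f (false ∷ x)
    f₁ = λ x → f (true ∷ x)
    regroup : ∀ a b c d → a * c + b * d ≡ (a + b) * c + b * (d - c)
    regroup = solve-∀
    ⟂-extend : ∀ {g} → w ⟂ extend g → (λ x → w₀ x + w₁ x) ⟂ g
    ⟂-extend {g} eq = begin
      ∑ (cube n) (λ x → (w₀ x + w₁ x) * g x)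
        ≡⟨ ∑-cong (cube n) (λ x → *-distribʳ-+ (g x) (w₀ x) (w₁ x)) ⟩
      ∑ (cube n) (λ x → w₀ x * g x + w₁ x * g x)
        ≡⟨ ∑-+ (cube n) (λ x → w₀ x * g x) (λ x → w₁ x * g x) ⟩
      ∑ (cube n) (λ x → w₀ x * g x) + ∑ (cube n) (λ x → w₁ x * g x)
        ≡⟨ sym (∑-cube-suc n (λ x → w x * extend g x)) ⟩
      ∑ (cube (suc n)) (λ x → w x * extend g x)
        ≡⟨ eq ⟩
      0ℤ ∎
    ⟂-times-head : ∀ {g} → w ⟂ times-head g → w₁ ⟂ g
    ⟂-times-head {g} eq = begin
      ∑ (cube n) (λ x → w₁ x * g x)
        ≡⟨ sym (+-identityˡ _) ⟩
      0ℤ + ∑ (cube n) (λ x → w₁ x * g x)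
        ≡⟨ cong (_+ ∑ (cube n) (λ x → w₁ x * g x))
             (sym (∑-0 (cube n) (λ x → *-zeroʳ (w₀ x)))) ⟩
      ∑ (cube n) (λ x → w₀ x * 0ℤ) + ∑ (cube n) (λ x → w₁ x * g x)
        ≡⟨ sym (∑-cube-suc n (λ x → w x * times-head g x)) ⟩
      ∑ (cube (suc n)) (λ x → w x * times-head g x)
        ≡⟨ eq ⟩
      0ℤ ∎

  -- Triangularity of monomials with respect to weight.

  monomial-self : ∀ {n} (S : Vec Bool n) → monomial S S ≡ 1
  monomial-self []          = refl
  monomial-self (false ∷ S) = monomial-self S
  monomial-self (true ∷ S)  = monomial-self S

  -- x^S is nonzero at x only when S ⊆ x, and a proper superset has larger weight.
  monomial-cases : ∀ {n} (S x : Vec Bool n) →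
    monomial S x ≡ 0 ⊎ x ≡ S ⊎ weight S ℕ.< weight x
  monomial-cases []          []          = inj₂ (inj₁ refl)
  monomial-cases (true ∷ S)  (false ∷ x) = inj₁ refl
  monomial-cases (false ∷ S) (false ∷ x) with monomial-cases S x
  ... | inj₁ m≡0          = inj₁ m≡0
  ... | inj₂ (inj₁ x≡S)   = inj₂ (inj₁ (cong (false ∷_) x≡S))
  ... | inj₂ (inj₂ S<x)   = inj₂ (inj₂ S<x)
  monomial-cases (true ∷ S)  (true ∷ x)  with monomial-cases S x
  ... | inj₁ m≡0          = inj₁ m≡0
  ... | inj₂ (inj₁ x≡S)   = inj₂ (inj₁ (cong (true ∷_) x≡S))
  ... | inj₂ (inj₂ S<x)   = inj₂ (inj₂ (ℕ.s≤s S<x))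
  monomial-cases (false ∷ S) (true ∷ x)  with monomial-cases S x
  ... | inj₁ m≡0          = inj₁ m≡0
  ... | inj₂ (inj₁ refl)  = inj₂ (inj₂ ℕ.≤-refl)
  ... | inj₂ (inj₂ S<x)   = inj₂ (inj₂ (ℕ.m<n⇒m<1+n S<x))

  weight-not : ∀ {n} (x : Vec Bool n) → weight (Vec.map not x) ℕ.+ weight x ≡ n
  weight-not []          = refl
  weight-not (false ∷ x) = cong suc (weight-not x)
  weight-not (true ∷ x)  = trans (ℕ.+-suc _ (weight x)) (cong suc (weight-not x))

  map-not-involutive : ∀ {n} (x : Vec Bool n) → Vec.map not (Vec.map not x) ≡ x
  map-not-involutive []      = refl
  map-not-involutive (b ∷ x) = cong₂ _∷_ (not-involutive b) (map-not-involutive x)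

  -- Testing u against x^S leaves u S plus values of u at points of larger weight,
  -- so the claim follows by downward induction on the weight.
  ball-divides : ∀ {m n} r (u : Fun n) → (∀ x → r ℕ.< weight x → u x ≡ 0ℤ) →
    (∀ S → weight S ℕ.≤ r → m ∣ ∑ (cube n) (λ x → u x * + monomial S x)) →
    ∀ x → m ∣ u x
  ball-divides {m} {n} r u u≡0 m∣∑ x =
    go (suc r) x (ℕ.m≤n+m (suc r) (weight x))
    where
    m∣0 : ∀ {z} → z ≡ 0ℤ → m ∣ z
    m∣0 refl = divides 0ℤ refl

    -- The fuel j exceeds r minus the weight of x; passing to a heavier point costs one unit, and
    -- with no fuel left x lies outside the ball, where u vanishes.
    go : ∀ j x → r ℕ.< weight x ℕ.+ j → m ∣ u x
    go zero    x r<x = m∣0 (u≡0 x (subst (r ℕ.<_) (ℕ.+-identityʳ _) r<x))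
    go (suc j) x r<x+j with r ℕ.<? weight x
    ... | yes r<x = m∣0 (u≡0 x r<x)
    ... | no  r≮x = subst (m ∣_) diagonal
      (∑-∣-term (cube-unique n) (∈-cube x) larger (m∣∑ x (ℕ.≮⇒≥ r≮x)))
      where
      diagonal : u x * + monomial x x ≡ u x
      diagonal = trans (cong (λ z → u x * + z) (monomial-self x)) (*-identityʳ (u x))

      larger : ∀ y → y ≢ x → m ∣ u y * + monomial x y
      larger y y≢x with monomial-cases x y
      ... | inj₁ m≡0        = m∣0 (trans (cong (λ z → u y * + z) m≡0) (*-zeroʳ (u y)))
      ... | inj₂ (inj₁ y≡x) = ⊥-elim (y≢x y≡x)
      ... | inj₂ (inj₂ x<y) = ∣m⇒∣m*n _ (go j y (ℕ.≤-trans r<x+j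
        (ℕ.≤-trans (ℕ.≤-reflexive (ℕ.+-suc (weight x) j)) (ℕ.+-monoˡ-≤ j x<y))))

  -- Congruences modulo powers of two.

  mod2^-∣ : ∀ k m → + (2 ℕ.^ k) ∣ + m - + mod2^ k m
  mod2^-∣ k m = divides (+ q) (begin
    + m - + mod2^ k m
      ≡⟨ cong (λ z → + z - + mod2^ k m) (ℕ.m≡m%n+[m/n]*n m (2 ℕ.^ k)) ⟩
    + (mod2^ k m ℕ.+ q ℕ.* 2 ℕ.^ k) - + mod2^ k m
      ≡⟨ cong (_- + mod2^ k m) (trans (pos-+ (mod2^ k m) _)
           (cong (_+_ (+ mod2^ k m)) (pos-* q (2 ℕ.^ k)))) ⟩
    + mod2^ k m + + q * + (2 ℕ.^ k) - + mod2^ k m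
      ≡⟨ cancel (+ mod2^ k m) (+ q * + (2 ℕ.^ k)) ⟩
    + q * + (2 ℕ.^ k) ∎)
    where
    instance _ = ℕ.m^n≢0 2 k
    q = m ℕ./ 2 ℕ.^ k
    cancel : ∀ a b → a + b - a ≡ b
    cancel = solve-∀

  mod2^-≡⇒∣ : ∀ k a b → mod2^ k a ≡ mod2^ k b → + (2 ℕ.^ k) ∣ + a - + b
  mod2^-≡⇒∣ k a b eq = subst (+ (2 ℕ.^ k) ∣_)
    (trans (cong (λ z → (+ a - + z) - (+ b - + mod2^ k b)) eq) (cancel (+ a) (+ b) (+ mod2^ k b)))
    (∣m∣n⇒∣m-n (mod2^-∣ k a) (mod2^-∣ k b))
    where
    cancel : ∀ a b r → (a - r) - (b - r) ≡ a - b
    cancel = solve-∀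

  sum-mod2^-∣ : ∀ {A : Set} k (a b : A → ℕ) xs →
    + (2 ℕ.^ k) ∣ + sum (map (λ S → a S ℕ.* b S) xs) - + sum (map (λ S → mod2^ k (a S) ℕ.* b S) xs)
  sum-mod2^-∣ k a b []       = divides 0ℤ refl
  sum-mod2^-∣ k a b (S ∷ xs) = subst (+ (2 ℕ.^ k) ∣_) (begin
      (+ a S - + mod2^ k (a S)) * + b S + (+ s - + s′)
        ≡⟨ regroup (+ a S) (+ mod2^ k (a S)) (+ b S) (+ s) (+ s′) ⟩
      (+ a S * + b S + + s) - (+ mod2^ k (a S) * + b S + + s′)
        ≡⟨ cong₂ _-_ (pos (a S) (b S) s) (pos (mod2^ k (a S)) (b S) s′) ⟩
      + (a S ℕ.* b S ℕ.+ s) - + (mod2^ k (a S) ℕ.* b S ℕ.+ s′) ∎)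
    (∣m∣n⇒∣m+n (∣m⇒∣m*n (+ b S) (mod2^-∣ k (a S))) (sum-mod2^-∣ k a b xs))
    where
    s  = sum (map (λ S → a S ℕ.* b S) xs)
    s′ = sum (map (λ S → mod2^ k (a S) ℕ.* b S) xs)
    regroup : ∀ a a′ b s s′ → (a - a′) * b + (s - s′) ≡ (a * b + s) - (a′ * b + s′)
    regroup = solve-∀
    pos : ∀ a b s → + a * + b + + s ≡ + (a ℕ.* b ℕ.+ s)
    pos a b s = sym (trans (pos-+ (a ℕ.* b) s) (cong (_+ + s) (pos-* a b)))

  countAgree≡length : ∀ {n} (f g : Vec Bool n → ℕ) xs →
    countAgree f g xs ≡ length (filterᵇ (λ x → f x ℕ.≡ᵇ g x) xs)
  countAgree≡length f g []       = refl
  countAgree≡length f g (x ∷ xs) with f x ℕ.≡ᵇ g x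
  ... | true  = cong suc (countAgree≡length f g xs)
  ... | false = countAgree≡length f g xs

  -- The agreement set and the functions supported on it that annihilate low degree.

  module Agreement {n : ℕ} (k d r : ℕ) (r*2≤n : r ℕ.* 2 ℕ.≤ n) (n≤1+r*2 : n ℕ.≤ suc (r ℕ.* 2))
                   (c : Poly n) (c-degree : DegLe (suc k) d c) where

    agree : Vec Bool n → Bool
    agree x = mod2^ (suc k) (lift (suc k) (Maj n x)) ℕ.≡ᵇ eval (suc k) c x

    -- Coefficients are reduced before summation because `DegLe` makes the high ones vanish only
    -- modulo 2^(suc k). After reduction they are zero, so Q has degree at most d over ℤ.
    Q : Fun n
    Q x = + sum (map (λ S → mod2^ (suc k) (c S) ℕ.* monomial S x) (cube n))

    deg-Q : Degree< (suc d) Q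
    deg-Q = deg-sum (λ S → mod2^ (suc k) (c S)) c-degree (cube n)

    lift-χ : ∀ b → + lift (suc k) b ≡ + (2 ℕ.^ k) * χ b
    lift-χ false = sym (*-zeroʳ (+ (2 ℕ.^ k)))
    lift-χ true  = sym (*-identityʳ (+ (2 ℕ.^ k)))

    -- Chains two congruences modulo 2^(suc k): agreement equates the lift with the unreduced sum,
    -- and reducing coefficients turns that sum into Q.
    agree⇒∣ : ∀ x → agree x ≡ true → + (2 ℕ.^ suc k) ∣ Q x - + (2 ℕ.^ k) * χ (Maj n x)
    agree⇒∣ x eq = subst (+ (2 ℕ.^ suc k) ∣_) (begin
        - (+ l - + s) - (+ s - Q x) ≡⟨ cancel (+ l) (+ s) (Q x) ⟩
        Q x - + l                   ≡⟨ cong (λ z → Q x - z) (lift-χ (Maj n x)) ⟩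
        Q x - + (2 ℕ.^ k) * χ (Maj n x) ∎)
      (∣m∣n⇒∣m-n
        (∣m⇒∣-m (mod2^-≡⇒∣ (suc k) l s (ℕ.≡ᵇ⇒≡ _ _ (Equivalence.from T-≡ eq))))
        (sum-mod2^-∣ (suc k) c (λ S → monomial S x) (cube n)))
      where
      l = lift (suc k) (Maj n x)
      s = sum (map (λ S → c S ℕ.* monomial S x) (cube n))
      cancel : ∀ l s q → - (l - s) - (s - q) ≡ q - l
      cancel = solve-∀

    Maj-heavy : ∀ x → r ℕ.< weight x → Maj n x ≡ true
    Maj-heavy x r<x = Equivalence.to T-≡ (ℕ.<⇒<ᵇ (ℕ.≤-trans (ℕ.s≤s n≤1+r*2)
      (ℕ.≤-trans (ℕ.*-monoˡ-≤ 2 r<x) (ℕ.≤-reflexive (ℕ.*-comm (weight x) 2)))))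

    -- Complementing a point of weight above r leaves weight at most r, since n ≤ 2r+1; then 2r ≤ n
    -- rules out a strict majority. This carries the heavy half of the cube into the ball of radius
    -- r.
    Maj-light : ∀ x → r ℕ.< weight x → Maj n (Vec.map not x) ≡ false
    Maj-light x r<x with Maj n (Vec.map not x) in eq
    ... | false = refl
    ... | true  = ⊥-elim (ℕ.<⇒≱ (ℕ.<ᵇ⇒< n _ (Equivalence.from T-≡ eq))
      (ℕ.≤-trans (ℕ.≤-reflexive (ℕ.*-comm 2 (weight (Vec.map not x))))
        (ℕ.≤-trans (ℕ.*-monoˡ-≤ 2 not-x≤r) r*2≤n)))
      where
      not-x≤r : weight (Vec.map not x) ℕ.≤ r
      not-x≤r = ℕ.+-cancelʳ-≤ (suc r) _ _ (ℕ.≤-trans (ℕ.+-monoʳ-≤ (weight (Vec.map not x)) r<x)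
        (ℕ.≤-trans (ℕ.≤-reflexive (weight-not x)) (ℕ.≤-trans n≤1+r*2 (ℕ.≤-reflexive double))))
        where
        double : suc (r ℕ.* 2) ≡ r ℕ.+ suc r
        double = trans
          (cong suc (trans (ℕ.*-comm r 2) (cong (r ℕ.+_) (ℕ.+-identityʳ r)))) (sym (ℕ.+-suc r r))

    deg-small-monomial : ∀ (S : Vec Bool n) → weight S ℕ.≤ r → Degree< (suc r) (λ x → + monomial S x)
    deg-small-monomial S S≤r = deg-weaken (ℕ.s≤s S≤r) (deg-monomial S)

    -- The degree bound is chosen to admit every product Q·B with B of degree at most r.
    record Annihilator (w : Fun n) : Set where
      field
        supported  : ∀ x → agree x ≡ false → w x ≡ 0ℤ
        orthogonal : ∀ {f} → Degree< (suc d ℕ.+ suc r) f → w ⟂ f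

    open Annihilator

    module _ {w : Fun n} (ann : Annihilator w) where

      -- w ⟂ Q·B, and Q ≡ 2^k · Maj modulo 2^(k+1) on the support of w.
      majority-even : ∀ {B} → Degree< (suc r) B →
        + 2 ∣ ∑ (cube n) (λ x → w x * χ (Maj n x) * B x)
      majority-even {B} deg-B = *-cancelˡ-∣ (+ (2 ℕ.^ k)) {{ℕ.m^n≢0 2 k}}
        (subst (_∣ + (2 ℕ.^ k) * ∑ (cube n) t) power
          (∣m+n∣m⇒∣n (subst (+ (2 ℕ.^ suc k) ∣_) (sym total) (divides 0ℤ refl))
            (∑-∣ (cube n) error-∣)))
        where
        -- Pointwise w·Q·B = error + 2^k·t. The left side sums to zero and each error is divisible
        -- by 2^(suc k), so 2^(suc k) divides 2^k·∑t.
        t error : Fun n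
        t x = w x * χ (Maj n x) * B x
        error x = w x * (Q x - + (2 ℕ.^ k) * χ (Maj n x)) * B x

        power : + (2 ℕ.^ suc k) ≡ + (2 ℕ.^ k) * + 2
        power = trans (pos-* 2 (2 ℕ.^ k)) (*-comm (+ 2) (+ (2 ℕ.^ k)))

        error-∣ : ∀ x → + (2 ℕ.^ suc k) ∣ error x
        error-∣ x with agree x in eq
        ... | true  = ∣m⇒∣m*n (B x) (∣n⇒∣m*n (w x) (agree⇒∣ x eq))
        ... | false = subst (λ z → + (2 ℕ.^ suc k) ∣ z * (Q x - + (2 ℕ.^ k) * χ (Maj n x)) * B x)
          (sym (supported ann x eq)) (divides 0ℤ refl)

        total : ∑ (cube n) error + + (2 ℕ.^ k) * ∑ (cube n) t ≡ 0ℤ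
        total = begin
          ∑ (cube n) error + + (2 ℕ.^ k) * ∑ (cube n) t
            ≡⟨ cong (_+_ (∑ (cube n) error)) (sym (∑-* (cube n) t (+ (2 ℕ.^ k)))) ⟩
          ∑ (cube n) error + ∑ (cube n) (λ x → + (2 ℕ.^ k) * t x)
            ≡⟨ sym (∑-+ (cube n) error (λ x → + (2 ℕ.^ k) * t x)) ⟩
          ∑ (cube n) (λ x → error x + + (2 ℕ.^ k) * t x)
            ≡⟨ ∑-cong (cube n) (λ x → collect (w x) (Q x) (+ (2 ℕ.^ k)) (χ (Maj n x)) (B x)) ⟩
          ∑ (cube n) (λ x → w x * (Q x * B x))
            ≡⟨ orthogonal ann (deg-* deg-Q deg-B) ⟩
          0ℤ ∎
          where
          collect : ∀ w q p m b → w * (q - p * m) * b + p * (w * m * b) ≡ w * (q * b)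
          collect = solve-∀

      -- The indicators of majority and minority add up to 1, and w is orthogonal to B itself, so
      -- this sum is the negative of the majority sum.
      minority-even : ∀ {B} → Degree< (suc r) B →
        + 2 ∣ ∑ (cube n) (λ x → w x * χ (not (Maj n x)) * B x)
      minority-even {B} deg-B = ∣m+n∣n⇒∣m
        (subst (+ 2 ∣_) (sym total) (divides 0ℤ refl)) (majority-even deg-B)
        where
        complement : ∀ w b m → w * χ (not m) * b + w * χ m * b ≡ w * b
        complement w b false = lemma w b
          where
          lemma : ∀ w b → w * 1ℤ * b + w * 0ℤ * b ≡ w * b
          lemma = solve-∀
        complement w b true = lemma w b
          where
          lemma : ∀ w b → w * 0ℤ * b + w * 1ℤ * b ≡ w * b
          lemma = solve-∀

        total : ∑ (cube n) (λ x → w x * χ (not (Maj n x)) * B x)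
              + ∑ (cube n) (λ x → w x * χ (Maj n x) * B x) ≡ 0ℤ
        total = begin
          ∑ (cube n) (λ x → w x * χ (not (Maj n x)) * B x)
            + ∑ (cube n) (λ x → w x * χ (Maj n x) * B x)
            ≡⟨ sym (∑-+ (cube n) (λ x → w x * χ (not (Maj n x)) * B x)
                                 (λ x → w x * χ (Maj n x) * B x)) ⟩
          ∑ (cube n) (λ x → w x * χ (not (Maj n x)) * B x + w x * χ (Maj n x) * B x)
            ≡⟨ ∑-cong (cube n) (λ x → complement (w x) (B x) (Maj n x)) ⟩
          ∑ (cube n) (λ x → w x * B x)
            ≡⟨ orthogonal ann (deg-weaken (ℕ.m≤n+m (suc r) (suc d)) deg-B) ⟩
          0ℤ ∎

      -- w·(1-Maj) vanishes above weight r, so its pairings with the x^S for |S| ≤ r decide its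
      -- divisibility.
      even-off-majority : ∀ x → + 2 ∣ w x * χ (not (Maj n x))
      even-off-majority = ball-divides r (λ x → w x * χ (not (Maj n x)))
        (λ x r<x → trans (cong (λ b → w x * χ (not b)) (Maj-heavy x r<x)) (*-zeroʳ (w x)))
        (λ S S≤r → minority-even {λ x → + monomial S x} (deg-small-monomial S S≤r))

      -- w·Maj lives on the heavy side, so the ball argument is applied to its reflection under x ↦
      -- 1-x; pairing the reflection with x^S amounts to pairing w·Maj with (1-x)^S.
      even-on-majority : ∀ x → + 2 ∣ w x * χ (Maj n x)
      even-on-majority x = subst (λ y → + 2 ∣ u y) (map-not-involutive x)
        (ball-divides r (λ y → u (Vec.map not y))
          (λ y r<y → trans (cong (λ b → w (Vec.map not y) * χ b) (Maj-light y r<y))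
            (*-zeroʳ (w (Vec.map not y))))
          (λ S S≤r → subst (+ 2 ∣_) (reflected S)
            (majority-even {λ y → + monomial S (Vec.map not y)} (deg-not (deg-small-monomial S S≤r))))
          (Vec.map not x))
        where
        u : Fun n
        u y = w y * χ (Maj n y)

        reflected : ∀ S → ∑ (cube n) (λ y → u y * + monomial S (Vec.map not y))
                        ≡ ∑ (cube n) (λ y → u (Vec.map not y) * + monomial S y)
        reflected S = trans (sym (∑-cube-not n (λ y → u y * + monomial S (Vec.map not y))))
          (∑-cong (cube n) (λ y → cong (λ z → u (Vec.map not y) * + monomial S z) (map-not-involutive y)))

      annihilator-even : ∀ x → + 2 ∣ w x
      annihilator-even x = cases (Maj n x) (even-off-majority x) (even-on-majority x)
        where
        cases : ∀ b → + 2 ∣ w x * χ (not b) → + 2 ∣ w x * χ b → + 2 ∣ w x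
        cases false 2∣w _   = subst (+ 2 ∣_) (*-identityʳ (w x)) 2∣w
        cases true  _   2∣w = subst (+ 2 ∣_) (*-identityʳ (w x)) 2∣w

      -- Both conditions are linear equations over ℤ, where the factor 2 can be cancelled.
      half-annihilator : Annihilator (λ x → quotient (annihilator-even x))
      half-annihilator = record
        { supported  = λ x eq → cancel-2
            (trans (sym (_∣_.equality (annihilator-even x))) (supported ann x eq))
        ; orthogonal = λ {f} deg-f → cancel-2 (begin
            ∑ (cube n) (λ x → v x * f x) * + 2
              ≡⟨ *-comm (∑ (cube n) (λ x → v x * f x)) (+ 2) ⟩
            + 2 * ∑ (cube n) (λ x → v x * f x)
              ≡⟨ sym (∑-* (cube n) (λ x → v x * f x) (+ 2)) ⟩
            ∑ (cube n) (λ x → + 2 * (v x * f x))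
              ≡⟨ ∑-cong (cube n) (λ x → trans (regroup (v x) (f x))
                   (cong (_* f x) (sym (_∣_.equality (annihilator-even x))))) ⟩
            ∑ (cube n) (λ x → w x * f x)
              ≡⟨ orthogonal ann deg-f ⟩
            0ℤ ∎)
        }
        where
        v : Fun n
        v x = quotient (annihilator-even x)
        cancel-2 : ∀ {z} → z * + 2 ≡ 0ℤ → z ≡ 0ℤ
        cancel-2 {z} eq with i*j≡0⇒i≡0∨j≡0 z eq
        ... | inj₁ z≡0 = z≡0
        regroup : ∀ a b → + 2 * (a * b) ≡ a * + 2 * b
        regroup = solve-∀

    -- Infinite descent at a fixed point x: j bounds the absolute value of w x, and replacing w by
    -- w/2 lowers the bound.
    annihilator-zero : ∀ {w} → Annihilator w → ∀ x → w x ≡ 0ℤ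
    annihilator-zero {w} ann x = descent ∣ w x ∣ ann ℕ.≤-refl
      where
      halve : ∀ a {j} → a ℕ.* 2 ℕ.≤ suc j → a ℕ.≤ j
      halve zero    _            = ℕ.z≤n
      halve (suc a) (ℕ.s≤s a*2<j) = ℕ.≤-trans (ℕ.s≤s (ℕ.m≤m*n a 2)) a*2<j

      descent : ∀ j {w} → Annihilator w → ∣ w x ∣ ℕ.≤ j → w x ≡ 0ℤ
      descent zero    ann w≤0 = ∣i∣≡0⇒i≡0 (ℕ.n≤0⇒n≡0 w≤0)
      descent (suc j) {w} ann w≤j = trans (_∣_.equality 2∣w)
        (cong (_* + 2) (descent j (half-annihilator ann) (halve _
          (subst (ℕ._≤ suc j)
            (trans (cong ∣_∣ (_∣_.equality 2∣w)) (abs-* (quotient 2∣w) (+ 2))) w≤j))))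
        where 2∣w = annihilator-even ann x

    -- With more agreement points than monomials of degree at most d+r+1, elimination would produce
    -- a weight that is nonzero somewhere on E yet yields an annihilator, and annihilators vanish.
    agreements-bound : agreements n (suc k) c ℕ.≤ binomialSum n (suc d ℕ.+ suc r)
    agreements-bound = ℕ.≮⇒≥ λ more → no-solution
      (nontrivial-solution (Unique.filter⁺ (T? ∘ agree) (cube-unique n)) (monomials< n e)
        (subst₂ ℕ._<_ (sym (length-monomials< n e)) (countAgree≡length _ _ (cube n)) more))
      where
      open Elimination (Vec.≡-dec Bool._≟_)

      e = suc d ℕ.+ suc r
      E = filterᵇ agree (cube n)

      no-solution : (∃ λ (w : Fun n) → Any (λ x → w x ≢ 0ℤ) E
        × All (λ g → ∑ E (λ x → w x * g x) ≡ 0ℤ) (monomials< n e)) → ⊥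
      no-solution (w , w≢0 , w⟂) with find w≢0
      ... | x , x∈E , wx≢0 = wx≢0 (begin
        w x               ≡⟨ sym (*-identityˡ (w x)) ⟩
        1ℤ * w x          ≡⟨ cong (λ b → χ b * w x) (sym x-agrees) ⟩
        χ (agree x) * w x ≡⟨ annihilator-zero ann x ⟩
        0ℤ                ∎)
        where
        x-agrees : agree x ≡ true
        x-agrees = Equivalence.to T-≡ (proj₂ (∈-filter⁻ (T? ∘ agree) {xs = cube n} x∈E))

        -- Elimination does not control w outside E; multiplying by the indicator extends it by zero
        -- and turns sums over E into sums over the cube.
        masked : Fun n
        masked x = χ (agree x) * w x

        masked⟂ : ∀ {g} → ∑ E (λ x → w x * g x) ≡ 0ℤ → masked ⟂ g
        masked⟂ {g} eq = trans
          (∑-cong (cube n) (λ x → *-assoc (χ (agree x)) (w x) (g x)))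
          (trans (sym (∑-filter agree (cube n) (λ x → w x * g x))) eq)

        ann : Annihilator masked
        ann = record
          { supported  = λ x eq → cong (λ b → χ b * w x) eq
          ; orthogonal = monomials<-span {w = masked} (All.map (λ {g} → masked⟂ {g}) w⟂)
          }

-- The bound on the agreement with majority.

open import Data.Nat using (ℕ; suc; _≤_; _*_; _∸_; _^_)
open import Data.Product using (_,_)
open Binomial using (half; Half⇒≤; Half⇒≥; excess-bound)
open Cube using (module Agreement)

-- With A agreements, A/2^n ≤ 1/2 + 10d/√n means √n (2A - 2^n) ≤ 20 d 2^n, and squaring gives the
-- integer form with 400 = 20^2. Truncated subtraction is faithful here: when 2A ≤ 2^n the original
-- inequality holds trivially.
theorem4p1 : (n k d : ℕ) → 1 ≤ n → 1 ≤ k → 1 ≤ d →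
    (c : Poly n) → DegLe k d c →
    n * ((2 * agreements n k c ∸ 2 ^ n) ^ 2) ≤ 400 * (d ^ 2) * ((2 ^ n) ^ 2)
theorem4p1 n (suc k) d _ _ 1≤d c c-degree with half n
... | r , h = excess-bound h d (agreements n (suc k) c) 1≤d agreements-bound
  where open Agreement k d r (Half⇒≥ h) (Half⇒≤ h) c c-degree
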